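{- Let $k\ge 3$ be an integer. Let $\mathcal{C}^{\mathrm{tyt}}_k$, $\mathcal{C}^{\mathrm{lse}}_k$, $\mathcal{P}^{\mathrm{tyt}}_k$, $\mathcal{P}^{\mathrm{lse}}_k$ denote the classes of $k$-uniform tight cycles, $k$-uniform loose cycles, $k$-uniform tight paths, and $k$-uniform loose paths, respectively. Then $$\chi_{\mathrm{co}}(\mathcal{C}^{\mathrm{tyt}}_k)=\chi_{\mathrm{co}}(\mathcal{C}^{\mathrm{lse}}_k)=\chi_{\mathrm{co}}(\mathcal{P}^{\mathrm{tyt}}_k)=\chi_{\mathrm{co}}(\mathcal{P}^{\mathrm{lse}}_k)=2.$$
   Context: A hypergraph is a pair $(V,E)$ where $V$ is a set (of vertices) and $E$ is a family of subsets of $V$ (edges); it is $k$-uniform if every edge has exactly $k$ vertices. A set $I\subseteq V$ is independent in $H=(V,E)$ if no edge of $H$ is contained in $I$. Given hypergraphs $H_1,\ldots,H_m$ (not necessarily distinct) with the same vertex set $V$, a cooperative coloring of them is a partition $\{I_1,\ldots,I_m\}$ of $V$ (indexed; parts may be empty) such that $I_i$ is independent in $H_i$ for each $i\in\{1,\ldots,m\}$. For a class $\mathcal{H}$ of hypergraphs, the cooperative chromatic number $\chi_{\mathrm{co}}(\mathcal{H})$ is the least number $m$ such that any $m$ hypergraphs (not necessarily distinct) from $\mathcal{H}$ on a common vertex set have a cooperative coloring. A $k$-uniform tight cycle is a $k$-uniform hypergraph whose vertices can be arranged in a sequence $v_0,v_1,\ldots,v_{n-1}$ of distinct vertices ($n\ge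 k$) such that its edges are exactly the sets $\{v_i,v_{i+1},\ldots,v_{i+k-1}\}$ for $i\in\mathbb{Z}_n$, with indices modulo $n$. A $k$-uniform loose cycle is a $k$-uniform hypergraph whose edges form a sequence $e_0,e_1,\ldots,e_{m-1}$ such that for each $i\in\mathbb{Z}_m$, $e_i\cap e_{i+1}=\{v_i\}$ (where $e_m=e_0$), all the vertices $v_i$ are distinct, and non-consecutive edges do not share any vertices; its vertex set is the union of its edges. A $k$-uniform tight path is a $k$-uniform hypergraph whose vertices can be arranged in a sequence $v_0,\ldots,v_{n-1}$ of distinct vertices ($n\ge k$) such that its edges are exactly the sets $\{v_i,v_{i+1},\ldots,v_{i+k-1}\}$ for $0\le i\le n-k$. A $k$-uniform loose path is a $k$-uniform hypergraph whose edges form a sequence $e_0,\ldots,e_{m-1}$ ($m\ge1$) such that $e_i\cap e_{i+1}=\{v_i\}$ for $0\le i\le m-2$, all the vertices $v_i$ are distinct, and non-consecutive edges do not share any vertices; its vertex set is the union of its edges. -}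

module Defs where

open import Level using (0ℓ)
open import Data.Nat using (ℕ; suc; _+_; _∸_; _≤_; _<_)
open import Data.Nat.DivMod using (_mod_)
open import Data.Fin using (Fin; toℕ; inject₁) renaming (suc to fsuc)
open import Data.Fin.Properties using (nonZeroIndex)
open import Data.Fin.Permutation using (Permutation′; _⟨$⟩ʳ_)
open import Data.Fin.Subset using (Subset; _∈_; _⊆_; _∩_; ⁅_⁆; ∣_∣; Empty)
open import Data.Product using (_×_; ∃; ∃-syntax; ∃!)
open import Function.Bundles using (_⇔_)
open import Function.Definitions using (Injective)
open import Relation.Nullary using (¬_)
open import Relation.Unary using (Pred)
open import Relation.Binary.PropositionalEquality using (_≡_; _≢_)

-- All hypergraphs considered are finite, so the vertex set is taken to be Fin n.
record Hypergraph (n : ℕ) : Set₁ where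
  constructor hypergraph
  field
    Edge : Pred (Subset n) 0ℓ

open Hypergraph public

Uniform : ℕ → ∀ {n} → Hypergraph n → Set
Uniform k H = ∀ s → Edge H s → ∣ s ∣ ≡ k

Independent : ∀ {n} → Hypergraph n → Subset n → Set
Independent H I = ∀ s → Edge H s → ¬ (s ⊆ I)

-- Parts are indexed and may be empty.
IsPartition : ∀ {n m} → (Fin m → Subset n) → Set
IsPartition I = ∀ x → ∃! _≡_ (λ i → x ∈ I i)

CooperativeColoring : ∀ {n m} → (Fin m → Hypergraph n) → Set
CooperativeColoring {n} {m} H =
  ∃[ I ] IsPartition {n} {m} I × (∀ i → Independent (H i) (I i))

HypergraphClass : Set₁
HypergraphClass = ∀ n → Hypergraph n → Set

CooperativelyColorable : HypergraphClass → ℕ → Set₁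
CooperativelyColorable 𝓗 m =
  ∀ n (H : Fin m → Hypergraph n) → (∀ i → 𝓗 n (H i)) → CooperativeColoring H

-- "χ-co 𝓗 is m": m is the least number such that any m members of 𝓗 on a
-- common vertex set have a cooperative coloring.
χ-co_is_ : HypergraphClass → ℕ → Set₁
χ-co 𝓗 is m =
  CooperativelyColorable 𝓗 m × (∀ m′ → CooperativelyColorable 𝓗 m′ → m ≤ m′)

-- Addition of a natural number to an index in ℤ_n.
_⊕_ : ∀ {n} → Fin n → ℕ → Fin n
i ⊕ j = (toℕ i + j) mod _
  where instance _ = nonZeroIndex i

-- s = { v_i , v_{i+1} , … , v_{i+k-1} }, indices modulo n.
IsCyclicWindow : ∀ {n} → ℕ → Permutation′ n → Fin n → Subset n → Set
IsCyclicWindow k v i s =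
  ∀ x → x ∈ s ⇔ (∃[ j ] j < k × x ≡ v ⟨$⟩ʳ (i ⊕ j))

-- s = { v_i , v_{i+1} , … , v_{i+k-1} }, without wrapping around.
IsWindow : ∀ {n} → ℕ → Permutation′ n → ℕ → Subset n → Set
IsWindow k v i s =
  ∀ x → x ∈ s ⇔ (∃[ p ] i ≤ toℕ p × toℕ p < i + k × x ≡ v ⟨$⟩ʳ p)

TightCycle : ℕ → HypergraphClass
TightCycle k n H =
  Uniform k H × k ≤ n ×
  ∃[ v ] (∀ s → Edge H s ⇔ (∃[ i ] IsCyclicWindow {n} k v i s))

TightPath : ℕ → HypergraphClass
TightPath k n H =
  Uniform k H × k ≤ n ×
  ∃[ v ] (∀ s → Edge H s ⇔ (∃[ i ] i ≤ n ∸ k × IsWindow {n} k v i s))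

record IsLooseCycle {n : ℕ} (H : Hypergraph n) : Set where
  field
    m           : ℕ
    1≤m         : 1 ≤ m
    e           : Fin m → Subset n
    v           : Fin m → Fin n
    edges       : ∀ s → Edge H s ⇔ (∃[ i ] s ≡ e i)
    consecutive : ∀ i → e i ∩ e (i ⊕ 1) ≡ ⁅ v i ⁆
    distinct    : Injective _≡_ _≡_ v
    disjoint    : ∀ i j → i ≢ j → j ≢ i ⊕ 1 → i ≢ j ⊕ 1 → Empty (e i ∩ e j)
    covering    : ∀ x → ∃[ i ] x ∈ e i

LooseCycle : ℕ → HypergraphClass
LooseCycle k n H = Uniform k H × IsLooseCycle H

-- The path has l + 1 edges e_0 , … , e_l and l connecting vertices
-- v_0 , … , v_{l-1}.
record IsLoosePath {n : ℕ} (H : Hypergraph n) : Set where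
  field
    l           : ℕ
    e           : Fin (suc l) → Subset n
    v           : Fin l → Fin n
    edges       : ∀ s → Edge H s ⇔ (∃[ i ] s ≡ e i)
    consecutive : ∀ i → e (inject₁ i) ∩ e (fsuc i) ≡ ⁅ v i ⁆
    distinct    : Injective _≡_ _≡_ v
    disjoint    : ∀ i j → suc (toℕ i) < toℕ j → Empty (e i ∩ e j)
    covering    : ∀ x → ∃[ i ] x ∈ e i

LoosePath : ℕ → HypergraphClass
LoosePath k n H = Uniform k H × IsLoosePath H

{-# OPTIONS --safe #-}
module Submission where

-- A cooperative colouring with two parts is a 2-colouring in which every edge of
-- the first hypergraph contains one colour and every edge of the second the
-- other. If the edges of both hypergraphs contain pairs from matchings M₀ and
-- M₁, this is achieved by alternating colours along the paths and even cycles of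
-- M₀ ∪ M₁. In a loose path or cycle the sets e_i minus one shared vertex are
-- disjoint, which yields such a matching; for a tight one the pairs
-- v_{2t} v_{2t+1} do, except for a single window when n is odd.

open import Defs
open import Data.Bool using (Bool; true; false; not)
open import Data.Bool.Properties using (not-involutive)
open import Data.Fin using (Fin; toℕ; inject₁) renaming (zero to fzero; suc to fsuc)
import Data.Fin.Properties as Fin
open import Data.Fin.Permutation using (Permutation′; _⟨$⟩ʳ_; _⟨$⟩ˡ_; inverseˡ; inverseʳ)
import Data.Fin.Permutation as Permutation
open import Data.Fin.Subset using (Subset; _∈_; ∣_∣; ⁅_⁆; _∩_; inside; outside) renaming (⊤ to full)
open import Data.Fin.Subset.Properties
  using (∈⊤; ∣⊤∣≡n; ⊆⊤; ⊆-antisym; x∈p∩q⁺; x∈⁅y⁆⇒x≡y)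
open import Data.List using (List; []; _∷_; length; tabulate; applyUpTo)
open import Data.List.Relation.Unary.All as All using (All; []; _∷_)
import Data.List.Relation.Unary.All.Properties as All
open import Data.List.Relation.Unary.AllPairs using (AllPairs; []; _∷_)
import Data.List.Relation.Unary.AllPairs.Properties as AllPairs
open import Data.List.Relation.Unary.Any as Any using (Any)
import Data.List.Relation.Unary.Any.Properties as Any
open import Data.List.Relation.Binary.Permutation.Propositional
  using (_↭_; ↭-refl; ↭-sym; ↭-trans; ↭-prep; ↭-swap)
open import Data.List.Relation.Binary.Permutation.Propositional.Properties
  using (All-resp-↭; ↭-length)
open import Data.Nat using (ℕ; zero; suc; _+_; _*_; _∸_; _≤_; _<_; z≤n; s≤s; z<s; s≤s⁻¹; NonZero)
open import Data.Nat.DivMod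
open import Data.Nat.Tactic.RingSolver using (solve-∀)
open import Data.Nat.Properties
open import Data.Product using (_×_; _,_; ∃; ∃-syntax; proj₁; proj₂)
open import Data.Sum using (_⊎_; inj₁; inj₂; [_,_]′)
open import Data.Vec using ([]; _∷_; here; there)
import Data.Vec as Vec
import Data.Vec.Properties as Vec
open import Data.Vec.Functional using (updateAt)
open import Data.Vec.Functional.Properties using (updateAt-updates; updateAt-minimal)
open import Function using (_∘_; const; id; case_of_)
open import Function.Bundles using (mk⇔; Equivalence)
open import Relation.Binary.Definitions using (tri<; tri≈; tri>)
open import Relation.Binary.PropositionalEquality
  using (_≡_; _≢_; refl; sym; trans; cong; subst; subst₂; module ≡-Reasoning)
open import Relation.Nullary using (¬_; yes; no; contradiction)
open Equivalence using (to; from)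

private variable
  n : ℕ

-- Matchings and a greedy two-colouring

Pair : ℕ → Set
Pair n = Fin n × Fin n

infix 4 _∈ₚ_ _⊑_

_∈ₚ_ : Fin n → Pair n → Set
x ∈ₚ (a , b) = x ≡ a ⊎ x ≡ b

Proper : Pair n → Set
Proper (a , b) = a ≢ b

Disjoint : Pair n → Pair n → Set
Disjoint p q = ∀ {x} → x ∈ₚ p → ¬ x ∈ₚ q

_⊑_ : Pair n → Subset n → Set
p ⊑ s = ∀ {x} → x ∈ₚ p → x ∈ s

Matching : List (Pair n) → Set
Matching L = All Proper L × AllPairs Disjoint L

Hit : (Fin n → Bool) → Bool → Pair n → Set
Hit c β p = ∃[ x ] x ∈ₚ p × c x ≡ β

hit-updateAt : ∀ {c : Fin n → Bool} {β p} x → Hit c β p → Hit (updateAt c x (const β)) β p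
hit-updateAt {c = c} x (y , y∈p , cy) with y Fin.≟ x
... | yes refl = y , y∈p , updateAt-updates y c
... | no y≢x = y , y∈p , trans (updateAt-minimal y x c y≢x) cy

hit-avoiding : ∀ {c : Fin n → Bool} {β γ p x} → ¬ x ∈ₚ p → Hit c β p →
  Hit (updateAt c x (const γ)) β p
hit-avoiding {c = c} {x = x} x∉p (y , y∈p , cy) =
  y , y∈p , trans (updateAt-minimal y x c (λ { refl → x∉p y∈p })) cy

-- The pair p that is split off is the one containing x, if there is one.
split-off : ∀ (x : Fin n) p L → Matching (p ∷ L) →
  ∃[ q ] ∃[ L′ ] (p ∷ L) ↭ (q ∷ L′) × Matching L′ × All (λ r → ¬ x ∈ₚ r) L′ ×
  ∃[ y ] y ∈ₚ q × y ≢ x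
split-off x (a , b) L (a≢b ∷ proper , p#L ∷ disjoint) with x Fin.≟ a | x Fin.≟ b
... | yes refl | _ = (a , b) , L , ↭-refl , (proper , disjoint) ,
  All.map (λ p#r → p#r (inj₁ refl)) p#L , b , inj₂ refl , a≢b ∘ sym
... | no _ | yes refl = (a , b) , L , ↭-refl , (proper , disjoint) ,
  All.map (λ p#r → p#r (inj₂ refl)) p#L , a , inj₁ refl , a≢b
split-off x (a , b) [] _ | no x≢a | no x≢b =
  (a , b) , [] , ↭-refl , ([] , []) , [] , a , inj₁ refl , x≢a ∘ sym
split-off x (a , b) (p ∷ L) (a≢b ∷ proper , p#L ∷ disjoint) | no x≢a | no x≢b
  with q , L′ , perm , (proper′ , disjoint′) , x∉L′ , rest ← split-off x p L (proper , disjoint)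
  with _ ∷ p#L′ ← All-resp-↭ perm p#L =
  q , (a , b) ∷ L′ , ↭-trans (↭-prep _ perm) (↭-swap _ _ ↭-refl) ,
  (a≢b ∷ proper′ , p#L′ ∷ disjoint′) , [ x≢a , x≢b ]′ ∷ x∉L′ , rest

-- Greedy: if x gets colour β, then a pair of L′ containing x must get the other
-- colour at its other point y; this pair is then settled, and the roles of
-- the two matchings are exchanged.
colour-two-matchings : ∀ m {L L′ : List (Pair n)} → length L + length L′ ≡ m →
  Matching L → Matching L′ → ∀ β x →
  ∃[ c ] c x ≡ β × All (Hit c β) L × All (Hit c (not β)) L′
colour-two-matchings m {L} {[]} _ _ _ β x =
  const β , refl , All.tabulate (λ {p} _ → proj₁ p , inj₁ refl , refl) , []
colour-two-matchings zero {L} {p ∷ L′} eq _ _ β x =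
  contradiction (trans (sym (+-suc (length L) _)) eq) λ ()
colour-two-matchings (suc m) {L} {p ∷ L′} eq ML ML′ β x
  with q , L″ , perm , ML″ , x∉L″ , y , y∈q , y≢x ← split-off x p L′ ML′
  with c , cy , hitL″ , hitL ← colour-two-matchings m {L″} {L}
    (suc-injective (trans (+-comm (suc (length L″)) (length L))
      (trans (cong (length L +_) (sym (↭-length perm))) eq)))
    ML″ ML (not β) y
  -- The recursive call says nothing about the colour of `x`, so `x` is recoloured `β`. This keeps
  -- the `β` hits of `L`, and also the hits of `L″`, none of whose pairs contains `x`; the pair `q`
  -- is hit at `y ≢ x`.
  = updateAt c x (const β) , updateAt-updates x c ,
    All.map (hit-updateAt x ∘ subst (λ γ → Hit c γ _) (not-involutive β)) hitL ,
    All-resp-↭ (↭-sym perm)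
      ((y , y∈q , trans (updateAt-minimal y x c y≢x) cy) ∷
       All.zipWith (λ (x∉r , hit) → hit-avoiding x∉r hit) (x∉L″ , hitL″))

-- From colourings to independent parts

HitsEdges : (Fin n → Bool) → Bool → Hypergraph n → Set
HitsEdges c β H = ∀ s → Edge H s → ∃[ x ] x ∈ s × c x ≡ β

hits-edge : ∀ {c : Fin n → Bool} {β s L} → All (Hit c β) L → Any (_⊑ s) L →
  ∃[ x ] x ∈ s × c x ≡ β
hits-edge hits any with (x , x∈p , cx) , p⊑s ← All.lookupAny hits any = x , p⊑s x∈p , cx

∈-tabulate⁺ : ∀ {c : Fin n → Bool} {x} → c x ≡ true → x ∈ Vec.tabulate c
∈-tabulate⁺ {c = c} {x} cx = Vec.lookup⇒[]= x _ (trans (Vec.lookup∘tabulate c x) cx)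

∈-tabulate⁻ : ∀ {c : Fin n → Bool} {x} → x ∈ Vec.tabulate c → c x ≡ true
∈-tabulate⁻ {c = c} {x} x∈ = trans (sym (Vec.lookup∘tabulate c x)) (Vec.[]=⇒lookup x∈)

colouring-from-hits : (H : Fin 2 → Hypergraph n) (c : Fin n → Bool) →
  HitsEdges c true (H fzero) → HitsEdges c false (H (fsuc fzero)) → CooperativeColoring H
colouring-from-hits {n} H c hit₀ hit₁ = I , partition , independent
  where
  I : Fin 2 → Subset n
  -- The colours are crossed: edges of the first hypergraph contain `true`, so its part collects the
  -- vertices coloured `false`.
  I fzero = Vec.tabulate (not ∘ c)
  I (fsuc fzero) = Vec.tabulate c

  partition : IsPartition I
  partition x with c x in cx
  ... | true = fsuc fzero , ∈-tabulate⁺ cx , unique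
    where
    unique : ∀ {i} → x ∈ I i → fsuc fzero ≡ i
    unique {fzero} x∈ = contradiction (trans (sym (∈-tabulate⁻ x∈)) (cong not cx)) λ ()
    unique {fsuc fzero} _ = refl
  ... | false = fzero , ∈-tabulate⁺ (cong not cx) , unique
    where
    unique : ∀ {i} → x ∈ I i → fzero ≡ i
    unique {fzero} _ = refl
    unique {fsuc fzero} x∈ = contradiction (trans (sym (∈-tabulate⁻ x∈)) cx) λ ()

  independent : ∀ i → Independent (H i) (I i)
  independent fzero s es s⊆ with x , x∈s , cx ← hit₀ s es =
    contradiction (trans (sym (∈-tabulate⁻ (s⊆ x∈s))) (cong not cx)) λ ()
  independent (fsuc fzero) s es s⊆ with x , x∈s , cx ← hit₁ s es =
    contradiction (trans (sym (∈-tabulate⁻ (s⊆ x∈s))) cx) λ ()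

Paired : Hypergraph n → Set
Paired H = ∃[ L ] Matching L × (∀ s → Edge H s → Any (_⊑ s) L)

colour-paired : (H : Fin 2 → Hypergraph n) → (∀ i → Paired (H i)) → CooperativeColoring H
colour-paired {zero} H paired =
  -- Without vertices there are no pairs, hence no edges; this case is separate because the greedy
  -- colouring needs a vertex to start from.
  (λ _ → []) , (λ ()) , λ i s es _ → case Any.satisfied (proj₂ (proj₂ (paired i)) s es) of λ ()
colour-paired {suc n} H paired
  with L₀ , M₀ , in₀ ← paired fzero
  with L₁ , M₁ , in₁ ← paired (fsuc fzero)
  with c , _ , hits₀ , hits₁ ← colour-two-matchings _ refl M₀ M₁ true fzero =
  colouring-from-hits H c (λ s es → hits-edge hits₀ (in₀ s es)) (λ s es → hits-edge hits₁ (in₁ s es))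

-- Loose paths and cycles

elements : ∀ m (s : Subset n) → m ≤ ∣ s ∣ →
  ∃ λ (f : Fin m → Fin n) → (∀ {i j} → f i ≡ f j → i ≡ j) × (∀ i → f i ∈ s)
elements zero s _ = (λ ()) , (λ { {()} }) , λ ()
elements (suc m) (outside ∷ s) m≤ with f , inj , f∈ ← elements (suc m) s m≤ =
  fsuc ∘ f , inj ∘ Fin.suc-injective , there ∘ f∈
elements (suc m) (inside ∷ s) m≤ with f , inj , f∈ ← elements m s (s≤s⁻¹ m≤) =
  g , g-injective , λ { fzero → here ; (fsuc i) → there (f∈ i) }
  where
  g : Fin (suc m) → Fin _
  g fzero = fzero
  g (fsuc i) = fsuc (f i)
  g-injective : ∀ {i j} → g i ≡ g j → i ≡ j
  g-injective {fzero} {fzero} _ = refl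
  g-injective {fsuc i} {fsuc j} eq = cong fsuc (inj (Fin.suc-injective eq))

two-avoiding : (f : Fin 3 → Fin n) → (∀ {i j} → f i ≡ f j → i ≡ j) → ∀ z →
  ∃[ i ] ∃[ j ] i ≢ j × f i ≢ z × f j ≢ z
two-avoiding f inj z with f fzero Fin.≟ z | f (fsuc fzero) Fin.≟ z
... | no a≢z | no b≢z = fzero , fsuc fzero , (λ ()) , a≢z , b≢z
... | yes refl | _ = fsuc fzero , fsuc (fsuc fzero) , (λ ()) ,
  (λ eq → case inj eq of λ ()) , (λ eq → case inj eq of λ ())
... | no a≢z | yes refl = fzero , fsuc (fsuc fzero) , (λ ()) ,
  a≢z , (λ eq → case inj eq of λ ())

-- For loose paths and cycles this is where `3 ≤ k` enters: an edge still has two vertices after one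
-- is removed.
pair-avoiding : (s : Subset n) → 3 ≤ ∣ s ∣ → ∀ z →
  ∃[ p ] Proper p × (∀ {x} → x ∈ₚ p → x ∈ s × x ≢ z)
pair-avoiding s 3≤s z
  with f , inj , f∈ ← elements 3 s 3≤s
  with i , j , i≢j , fi≢z , fj≢z ← two-avoiding f inj z =
  (f i , f j) , i≢j ∘ inj , λ { (inj₁ refl) → f∈ i , fi≢z ; (inj₂ refl) → f∈ j , fj≢z }

-- Choose in each `e i` a pair avoiding `z i`. A vertex common to two chosen pairs would lie in both
-- edges, hence be one of the two avoided vertices.
paired-of-almost-disjoint : ∀ {m} {H : Hypergraph n} (e : Fin m → Subset n) (z : Fin m → Fin n) →
  (∀ s → Edge H s → ∃[ i ] s ≡ e i) → (∀ i → 3 ≤ ∣ e i ∣) →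
  (∀ {i j x} → i ≢ j → x ∈ e i → x ∈ e j → x ≡ z i ⊎ x ≡ z j) → Paired H
paired-of-almost-disjoint {n} {m} e z edges size meet =
  tabulate pair ,
  (All.tabulate⁺ (proj₁ ∘ proj₂ ∘ choice) , AllPairs.tabulate⁺ disjoint) ,
  λ s es → case edges s es of λ { (i , refl) → Any.tabulate⁺ {P = _⊑ e i} i (λ {x} x∈p → proj₁ (inside-edge i {x} x∈p)) }
  where
  choice : ∀ i → _
  choice i = pair-avoiding (e i) (size i) (z i)
  pair : Fin m → Pair n
  pair = proj₁ ∘ choice
  inside-edge : ∀ i {x} → x ∈ₚ pair i → x ∈ e i × x ≢ z i
  inside-edge i = proj₂ (proj₂ (choice i))
  disjoint : ∀ {i j} → i ≢ j → Disjoint (pair i) (pair j)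
  disjoint {i} {j} i≢j x∈i x∈j
    with x∈ei , x≢zi ← inside-edge i x∈i | x∈ej , x≢zj ← inside-edge j x∈j =
    [ x≢zi , x≢zj ]′ (meet i≢j x∈ei x∈ej)

∈-singleton-∩ : ∀ {p q : Subset n} {x y} → p ∩ q ≡ ⁅ y ⁆ → x ∈ p → x ∈ q → x ≡ y
∈-singleton-∩ {x = x} eq x∈p x∈q = x∈⁅y⁆⇒x≡y _ (subst (x ∈_) eq (x∈p∩q⁺ (x∈p , x∈q)))

-- Each edge avoids the vertex it shares with its successor. Distinct edges that meet are
-- consecutive, so one of them avoids their common vertex.
looseCycle-paired : ∀ {k} → 3 ≤ k → {H : Hypergraph n} → LooseCycle k n H → Paired H
looseCycle-paired 3≤k {H} (uniform , loose) =
  paired-of-almost-disjoint {H = H} e v (λ s → to (edges s))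
    (λ i → subst (3 ≤_) (sym (uniform (e i) (from (edges _) (i , refl)))) 3≤k) meet
  where
  open IsLooseCycle loose
  meet : ∀ {i j x} → i ≢ j → x ∈ e i → x ∈ e j → x ≡ v i ⊎ x ≡ v j
  meet {i} {j} i≢j x∈i x∈j with j Fin.≟ (i ⊕ 1) | i Fin.≟ (j ⊕ 1)
  ... | yes refl | _ = inj₁ (∈-singleton-∩ (consecutive i) x∈i x∈j)
  ... | no _ | yes refl = inj₂ (∈-singleton-∩ (consecutive j) x∈j x∈i)
  ... | no j≢ | no i≢ = contradiction (_ , x∈p∩q⁺ (x∈i , x∈j)) (disjoint i j i≢j j≢ i≢)

-- Here each edge avoids the vertex shared with its predecessor, so of two edges that meet the later
-- one avoids the common vertex.
loosePath-paired : ∀ {k} → 3 ≤ k → {H : Hypergraph n} → LoosePath k n H → Paired H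
loosePath-paired {n} 3≤k {H} (uniform , loose) =
  paired-of-almost-disjoint {H = H} e z (λ s → to (edges s)) size meet
  where
  open IsLoosePath loose
  size : ∀ i → 3 ≤ ∣ e i ∣
  size i = subst (3 ≤_) (sym (uniform (e i) (from (edges _) (i , refl)))) 3≤k
  -- The first edge meets no earlier one, so the vertex avoided in it is arbitrary.
  z : Fin (suc l) → Fin n
  z fzero = proj₁ (elements 3 (e fzero) (size fzero)) fzero
  z (fsuc i) = v i
  meet-< : ∀ i j {x} → toℕ i < toℕ j → x ∈ e i → x ∈ e j → x ≡ z j
  meet-< i (fsuc j) i<j x∈i x∈j with suc (toℕ i) <? suc (toℕ j)
  ... | yes lt = contradiction (_ , x∈p∩q⁺ (x∈i , x∈j)) (disjoint i (fsuc j) lt)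
  ... | no ≮ = ∈-singleton-∩ (consecutive j) (subst (λ t → _ ∈ e t) i≡j x∈i) x∈j
    where
    i≡j : i ≡ inject₁ j
    i≡j = Fin.toℕ-injective (trans (≤-antisym (s≤s⁻¹ i<j) (s≤s⁻¹ (≮⇒≥ ≮))) (sym (Fin.toℕ-inject₁ j)))
  meet : ∀ {i j x} → i ≢ j → x ∈ e i → x ∈ e j → x ≡ z i ⊎ x ≡ z j
  meet {i} {j} i≢j x∈i x∈j with <-cmp (toℕ i) (toℕ j)
  ... | tri< i<j _ _ = inj₂ (meet-< i j i<j x∈i x∈j)
  ... | tri≈ _ eq _ = contradiction (Fin.toℕ-injective eq) i≢j
  ... | tri> _ _ j<i = inj₁ (meet-< j i j<i x∈j x∈i)

-- Tight paths and cycles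

+-right-comm : ∀ a b c → a + b + c ≡ a + c + b
+-right-comm = solve-∀

-- A cyclic order of the vertices, unrolled to a periodic sequence on the natural numbers: windows
-- that wrap around become ordinary intervals.
record CyclicSequence {n : ℕ} (f : ℕ → Fin n) : Set where
  field
    distinct   : ∀ {i j} → i < j → j < i + n → f i ≢ f j
    periodic   : ∀ i → f (i + n) ≡ f i
    surjective : ∀ x → ∃[ i ] f i ≡ x

  periodic-* : ∀ i k → f (i + k * n) ≡ f i
  periodic-* i zero = cong f (+-identityʳ i)
  periodic-* i (suc k) = trans (cong f (shuffle i n (k * n))) (trans (periodic _) (periodic-* i k))
    where
    shuffle : ∀ a b c → a + (b + c) ≡ a + c + b
    shuffle = solve-∀

  distinct-< : ∀ {i j} → i < n → j < n → i ≢ j → f i ≢ f j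
  distinct-< {i} {j} i<n j<n i≢j with <-cmp i j
  ... | tri< i<j _ _ = distinct i<j (≤-trans j<n (m≤n+m n i))
  ... | tri≈ _ i≡j _ = contradiction i≡j i≢j
  ... | tri> _ _ j<i = distinct j<i (≤-trans i<n (m≤n+m n j)) ∘ sym

open CyclicSequence

-- The offset comes first so that `j + i` reduces for the numerals 0, 1 and 2.
TripleIn : (ℕ → Fin n) → Subset n → ℕ → Set
TripleIn f s i = ∀ j → j < 3 → f (j + i) ∈ s

ContainsTriples : (ℕ → Fin n) → Hypergraph n → Set
ContainsTriples f H = ∀ s → Edge H s → ∃[ i ] TripleIn f s i

-- The common weakening of tight cycles and tight paths: the edges of a path are windows of the
-- cycle with the same vertex order, and for `k ≥ 3` a window contains three consecutive vertices.
Tight : Hypergraph n → Set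
Tight H = ∃[ f ] CyclicSequence f × ContainsTriples f H

triple-cong : ∀ (f g : ℕ → Fin n) {s i i′} → (∀ j → g (j + i′) ≡ f (j + i)) →
  TripleIn f s i → TripleIn g s i′
triple-cong f g {s} eq triple j j<3 = subst (_∈ s) (sym (eq j)) (triple j j<3)

module _ {f : ℕ → Fin (suc n)} (cyclic : CyclicSequence f) (r : ℕ) where

  rotated : ℕ → Fin (suc n)
  rotated i = f (i + r)

  -- Shifting by `r * n` and then by `r` amounts to `r` full periods of length `suc n`; this undoes
  -- the rotation without subtraction.
  unrotate : ∀ i j → rotated (j + (i + r * n)) ≡ f (j + i)
  unrotate i j = trans (cong f (shuffle j i r n)) (periodic-* cyclic (j + i) r)
    where
    shuffle : ∀ j i r n → j + (i + r * n) + r ≡ j + i + r * suc n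
    shuffle = solve-∀

  rotated-cyclic : CyclicSequence rotated
  rotated-cyclic .distinct {i} {j} i<j j<i+n =
    distinct cyclic (+-monoˡ-< r i<j)
      (subst (j + r <_) (+-right-comm i (suc n) r) (+-monoˡ-< r j<i+n))
  rotated-cyclic .periodic i = trans (cong f (+-right-comm i (suc n) r)) (periodic cyclic (i + r))
  rotated-cyclic .surjective x with i , refl ← surjective cyclic x = i + r * n , unrotate i 0

  rotated-triples : ∀ {H} → ContainsTriples f H → ContainsTriples rotated H
  rotated-triples triples s es with i , triple ← triples s es =
    i + r * n , triple-cong f rotated (unrotate i) triple

-- Doubling is written `t * 2` because `suc t * 2` reduces to `2 + t * 2`.
evenPairs : (ℕ → Fin n) → ℕ → List (Pair n)
evenPairs f = applyUpTo (λ t → f (t * 2) , f (1 + t * 2))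

*2-injective : ∀ {t u} → t * 2 ≡ u * 2 → t ≡ u
*2-injective {t} {u} = *-cancelʳ-≡ t u 2

even≢odd′ : ∀ t u → t * 2 ≢ 1 + u * 2
even≢odd′ (suc t) (suc u) eq = even≢odd′ t u (suc-injective (suc-injective eq))

parity : ∀ i → ∃[ t ] (i ≡ t * 2 ⊎ i ≡ 1 + t * 2)
parity zero = 0 , inj₁ refl
parity (suc i) with parity i
... | t , inj₁ refl = t , inj₂ refl
... | t , inj₂ refl = suc t , inj₁ refl

module _ {f : ℕ → Fin n} (cyclic : CyclicSequence f) {h : ℕ} (2h≤n : h * 2 ≤ n) where

  odd-position : ∀ {t} → t < h → 1 + t * 2 < n
  odd-position t<h = ≤-trans (*-monoˡ-≤ 2 t<h) 2h≤n

  even-position : ∀ {t} → t < h → t * 2 < n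
  even-position t<h = <-trans (n<1+n _) (odd-position t<h)

  evenPairs-matching : Matching (evenPairs f h)
  evenPairs-matching =
    All.applyUpTo⁺₁ _ h (λ t<h → distinct-< cyclic (even-position t<h) (odd-position t<h) (m≢1+n+m _ {0})) ,
    AllPairs.applyUpTo⁺₁ _ h disjoint
    where
    disjoint : ∀ {t u} → t < u → u < h → Disjoint (f (t * 2) , f (1 + t * 2)) (f (u * 2) , f (1 + u * 2))
    disjoint {t} {u} t<u u<h =
      λ { (inj₁ refl) (inj₁ eq) → distinct-< cyclic (even-position t<h) (even-position u<h) (<⇒≢ t<u ∘ *2-injective) eq
        ; (inj₁ refl) (inj₂ eq) → distinct-< cyclic (even-position t<h) (odd-position u<h) (even≢odd′ t u) eq
        ; (inj₂ refl) (inj₁ eq) → distinct-< cyclic (odd-position t<h) (even-position u<h) (even≢odd′ u t ∘ sym) eq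
        ; (inj₂ refl) (inj₂ eq) → distinct-< cyclic (odd-position t<h) (odd-position u<h) (<⇒≢ t<u ∘ *2-injective ∘ suc-injective) eq }
      where
      t<h : t < h
      t<h = <-trans t<u u<h

  -- For odd `n` the pairs fill the positions below `h * 2`, which leaves over only the last
  -- position of the period.
  fresh-last : n ≡ 1 + h * 2 → All (λ p → ¬ f (h * 2) ∈ₚ p) (evenPairs f h)
  fresh-last refl = All.applyUpTo⁺₁ _ h λ {t} t<h →
    λ { (inj₁ eq) → distinct-< cyclic (n<1+n _) (even-position t<h) (<⇒≢ t<h ∘ sym ∘ *2-injective) eq
      ; (inj₂ eq) → distinct-< cyclic (n<1+n _) (odd-position t<h) (even≢odd′ h t) eq }

  pair-in : ∀ {s t} → t < h → f (t * 2) ∈ s → f (1 + t * 2) ∈ s → Any (_⊑ s) (evenPairs f h)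
  pair-in t<h a∈s b∈s = Any.applyUpTo⁺ {P = _⊑ _} _ (λ { (inj₁ refl) → a∈s ; (inj₂ refl) → b∈s }) t<h

  module _ .{{_ : NonZero n}} where

    reduce : ∀ i j → f (j + i % n) ≡ f (j + i)
    reduce i j = trans (sym (periodic-* cyclic (j + i % n) (i / n)))
      (cong f (trans (+-assoc j (i % n) _) (cong (j +_) (sym (m≡m%n+[m/n]*n i n)))))

    -- Only for odd n can a triple miss all pairs, and then it is the one
    -- starting at n - 2.
    triple-meets-pairs : ∀ {s i} → 0 < h → n ≤ 1 + h * 2 → TripleIn f s i →
      Any (_⊑ s) (evenPairs f h) ⊎ (n ≡ 1 + h * 2 × f (h * 2) ∈ s × f 0 ∈ s)
    triple-meets-pairs {s} {i} 0<h n≤ triple = below (i % n) (m%n<n i n) (triple-cong f f (reduce i) triple)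
      where
      wrap : ∀ {a} j → a ≡ n → f (j + a) ∈ s → f j ∈ s
      wrap j refl = subst (_∈ s) (periodic cyclic j)
      below : ∀ i → i < n → TripleIn f s i →
        Any (_⊑ s) (evenPairs f h) ⊎ (n ≡ 1 + h * 2 × f (h * 2) ∈ s × f 0 ∈ s)
      below i i<n triple with parity i
      below _ i<n triple | t , inj₁ refl with <-cmp t h
      ... | tri< t<h _ _ = inj₁ (pair-in t<h (triple 0 (s≤s z≤n)) (triple 1 (s≤s (s≤s z≤n))))
      -- The triple starts at `n - 1`, so its other two positions wrap around to 0 and 1, the first
      -- pair.
      ... | tri≈ _ refl _ = inj₁ (pair-in 0<h
        (wrap 0 (≤-antisym i<n n≤) (triple 1 (s≤s (s≤s z≤n)))) (wrap 1 (≤-antisym i<n n≤) (triple 2 ≤-refl)))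
      ... | tri> _ _ h<t = contradiction
        (≤-trans (≤-trans (s≤s (n≤1+n _)) (*-monoˡ-≤ 2 h<t)) (s≤s⁻¹ (≤-trans i<n n≤))) (<-irrefl refl)
      below _ i<n triple | t , inj₂ refl with <-cmp (suc t) h
      -- From an odd start the pair consists of the second and third vertices of the triple.
      ... | tri< t<h _ _ = inj₁ (pair-in t<h (triple 1 (s≤s (s≤s z≤n))) (triple 2 ≤-refl))
      ... | tri≈ _ refl _ with m≤n⇒m<n∨m≡n n≤
      -- Here `n` is `h * 2` and the start is again `n - 1`; in the other case the start is `n - 2`,
      -- and the triple continues with `n - 1` and 0.
      ...   | inj₁ n< = inj₁ (pair-in 0<h (wrap 0 n≡ (triple 1 (s≤s (s≤s z≤n)))) (wrap 1 n≡ (triple 2 ≤-refl)))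
        where
        n≡ : 2 + t * 2 ≡ n
        n≡ = ≤-antisym i<n (s≤s⁻¹ n<)
      ...   | inj₂ n≡ = inj₂ (n≡ , triple 1 (s≤s (s≤s z≤n)) , wrap 0 (sym n≡) (triple 2 ≤-refl))
      below _ i<n triple | t , inj₂ refl | tri> _ _ h<1+t = contradiction
        (≤-trans (s≤s (s≤s (*-monoˡ-≤ 2 (s≤s⁻¹ h<1+t)))) (≤-trans i<n n≤)) (<-irrefl refl)

-- For odd n the two sequences are rotated so that they leave the same vertex x
-- unpaired. Giving x and the successor of x in the second sequence different
-- colours settles the triples that contain no pair.
colour-tight : (H : Fin 2 → Hypergraph n) → 2 ≤ n → (∀ i → Tight (H i)) → CooperativeColoring H
colour-tight {n@(suc _)} H 2≤n tight with parity n
... | h , inj₁ n≡2h = colour-paired H λ i → case tight i of λ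
  { (f , cyclic , triples) → evenPairs f h , evenPairs-matching cyclic (≤-reflexive (sym n≡2h)) ,
    λ s es → case triple-meets-pairs cyclic (≤-reflexive (sym n≡2h)) 0<h
                    (≤-trans (≤-reflexive n≡2h) (n≤1+n _)) (proj₂ (triples s es)) of λ
      { (inj₁ found) → found
      ; (inj₂ (n≡1+2h , _)) → contradiction (trans (sym n≡2h) n≡1+2h) (m≢1+n+m _ {0}) } }
  where
  0<h : 0 < h
  0<h = *-cancelʳ-< 2 0 h (subst (0 <_) n≡2h z<s)
... | h , inj₂ refl
  with f , cyclic-f , triples-f ← tight fzero
  with g′ , cyclic-g′ , triples-g′ ← tight (fsuc fzero)
  with r , g′r≡x ← surjective cyclic-g′ (f (h * 2)) =
  colouring-from-hits H c′ hit₀ hit₁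
  where
  0<h : 0 < h
  0<h = *-cancelʳ-< 2 0 h (s≤s⁻¹ 2≤n)
  2h≤n : h * 2 ≤ 1 + h * 2
  2h≤n = n≤1+n _
  x : Fin n
  x = f (h * 2)
  g : ℕ → Fin n
  -- Starting just after the position `r` of `x` puts `x` at the end of the period, at position
  -- `h * 2`.
  g = rotated cyclic-g′ (suc r)
  cyclic-g : CyclicSequence g
  cyclic-g = rotated-cyclic cyclic-g′ (suc r)
  shuffle : ∀ a b → a + suc b ≡ b + suc a
  shuffle = solve-∀
  g-last : g (h * 2) ≡ x
  g-last = trans (cong g′ (shuffle (h * 2) r)) (trans (periodic cyclic-g′ r) g′r≡x)
  g0≢x : g 0 ≢ x
  g0≢x = subst (g 0 ≢_) g-last (distinct-< cyclic-g z<s (n<1+n _) (<⇒≢ (*-monoˡ-< 2 0<h)))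
  colouring : _
  -- The matching of `g` comes first, so its pairs are hit by `false`, the colour prescribed at
  -- `g 0`.
  colouring = colour-two-matchings _ refl
    (evenPairs-matching cyclic-g 2h≤n) (evenPairs-matching cyclic-f 2h≤n) false (g 0)
  c c′ : Fin n → Bool
  c = proj₁ colouring
  -- Giving `x` the colour `true` keeps the `true` hits for `f` and does not affect the pairs of
  -- `g`, none of which contains `x`.
  c′ = updateAt c x (const true)
  hits-f : All (Hit c′ true) (evenPairs f h)
  hits-f = All.map (hit-updateAt x) (proj₂ (proj₂ (proj₂ colouring)))
  hits-g : All (Hit c′ false) (evenPairs g h)
  hits-g = All.zipWith (λ (x∉p , hit) → hit-avoiding x∉p hit)
    ( subst (λ y → All (λ p → ¬ y ∈ₚ p) (evenPairs g h)) g-last (fresh-last cyclic-g 2h≤n refl)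
    , proj₁ (proj₂ (proj₂ colouring)))
  hit₀ : HitsEdges c′ true (H fzero)
  hit₀ s es with triple-meets-pairs cyclic-f 2h≤n 0<h ≤-refl (proj₂ (triples-f s es))
  ... | inj₁ found = hits-edge hits-f found
  ... | inj₂ (_ , x∈s , _) = x , x∈s , updateAt-updates x c
  hit₁ : HitsEdges c′ false (H (fsuc fzero))
  hit₁ s es
    with triple-meets-pairs cyclic-g 2h≤n 0<h ≤-refl
           (proj₂ (rotated-triples cyclic-g′ (suc r) {H (fsuc fzero)} triples-g′ s es))
  ... | inj₁ found = hits-edge hits-g found
  ... | inj₂ (_ , _ , g0∈s) = g 0 , g0∈s , trans (updateAt-minimal (g 0) x c g0≢x) (proj₁ (proj₂ colouring))

-- Tight cycles and paths as cyclic sequences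

module _ (v : Permutation′ (suc n)) where

  unrolled : ℕ → Fin (suc n)
  unrolled i = v ⟨$⟩ʳ (i mod suc n)

  unrolled-cyclic : CyclicSequence unrolled
  unrolled-cyclic .periodic i = cong (v ⟨$⟩ʳ_)
    (Fin.fromℕ<-cong _ _ ([m+n]%n≡m%n i (suc n)) _ _)
  unrolled-cyclic .surjective x = toℕ (v ⟨$⟩ˡ x) , trans
    (cong (v ⟨$⟩ʳ_) (Fin.toℕ-injective
      (trans (Fin.toℕ-fromℕ< _) (m<n⇒m%n≡m (Fin.toℕ<n (v ⟨$⟩ˡ x))))))
    (inverseʳ v)
  -- Equal values mean equal remainders modulo `d`, as `v` is injective; then `i < j` forces a
  -- larger quotient, so `j` is at least a full period beyond `i`.
  unrolled-cyclic .distinct {i} {j} i<j j<i+n eq = <⇒≱ j<i+n i+n≤j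
    where
    d = suc n
    i%≡j% : i % d ≡ j % d
    i%≡j% = subst₂ _≡_ (Fin.toℕ-fromℕ< (m%n<n i d)) (Fin.toℕ-fromℕ< (m%n<n j d))
      (cong toℕ (trans (sym (inverseˡ v)) (trans (cong (v ⟨$⟩ˡ_) eq) (inverseˡ v))))
    i/<j/ : i / d < j / d
    i/<j/ = ≰⇒> λ j/≤i/ → <⇒≱ i<j (subst₂ _≤_ (sym (m≡m%n+[m/n]*n j d)) (sym (m≡m%n+[m/n]*n i d))
      (+-mono-≤ (≤-reflexive (sym i%≡j%)) (*-monoˡ-≤ d j/≤i/)))
    shuffle : ∀ a b c → a + (c + b) ≡ a + b + c
    shuffle = solve-∀
    i+n≤j : i + d ≤ j
    i+n≤j = begin
      i + d                        ≡⟨ cong (_+ d) (m≡m%n+[m/n]*n i d) ⟩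
      i % d + i / d * d + d        ≡⟨ shuffle (i % d) (i / d * d) d ⟨
      i % d + suc (i / d) * d      ≤⟨ +-mono-≤ (≤-reflexive i%≡j%) (*-monoˡ-≤ d i/<j/) ⟩
      j % d + j / d * d            ≡⟨ m≡m%n+[m/n]*n j d ⟨
      j                            ∎
      where open ≤-Reasoning

tightCycle-tight : ∀ {k} → 3 ≤ k → {H : Hypergraph n} → TightCycle k n H → Tight H
tightCycle-tight {zero} 3≤k (_ , k≤n , _) = contradiction (≤-trans 3≤k k≤n) λ ()
tightCycle-tight {suc n} 3≤k {H} (_ , _ , v , edges) = unrolled v , unrolled-cyclic v , triples
  where
  triples : ContainsTriples (unrolled v) H
  triples s es with i , window ← to (edges s) es = toℕ i , λ j j<3 →
    from (window _) (j , ≤-trans j<3 3≤k , cong (unrolled v) (+-comm j (toℕ i)))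

tightPath-tight : ∀ {k} → 3 ≤ k → {H : Hypergraph n} → TightPath k n H → Tight H
tightPath-tight {zero} 3≤k (_ , k≤n , _) = contradiction (≤-trans 3≤k k≤n) λ ()
tightPath-tight {suc n} {k} 3≤k {H} (_ , k≤n , v , edges) = unrolled v , unrolled-cyclic v , triples
  where
  triples : ContainsTriples (unrolled v) H
  triples s es with i , i≤n∸k , window ← to (edges s) es = i , λ j j<3 →
    let j+i<i+k : j + i < i + k
        j+i<i+k = subst (_< i + k) (+-comm i j) (+-monoʳ-< i (≤-trans j<3 3≤k))
        -- A window of a path does not wrap: `i ≤ suc n ∸ k` keeps `j + i` below `suc n`, so the
        -- reduction changes nothing.
        position : toℕ ((j + i) mod suc n) ≡ j + i
        position = trans (Fin.toℕ-fromℕ< _)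
          (m<n⇒m%n≡m (≤-trans j+i<i+k (m≤o∸n⇒m+n≤o i k≤n i≤n∸k)))
    in from (window _) ((j + i) mod suc n ,
         subst (i ≤_) (sym position) (m≤n+m i j) , subst (_< i + k) (sym position) j+i<i+k , refl)

-- Lower bounds

HasEdge : HypergraphClass → Set₁
HasEdge 𝓗 = ∃[ n ] ∃[ H ] 𝓗 n H × ∃[ s ] Edge H s

-- With no parts, a single vertex cannot be covered. With one part, that part is the whole vertex
-- set and contains an edge.
colourable⇒2≤ : ∀ {𝓗} → HasEdge 𝓗 → ∀ m → CooperativelyColorable 𝓗 m → 2 ≤ m
colourable⇒2≤ _ zero colour with I , partition , _ ← colour 1 (λ ()) (λ ())
  with () , _ ← partition fzero
colourable⇒2≤ (n , H , H∈ , s , es) (suc zero) colour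
  with I , partition , independent ← colour n (λ _ → H) (λ _ → H∈) =
  contradiction (λ {x} _ → everywhere x) (independent fzero s es)
  where
  everywhere : ∀ x → x ∈ I fzero
  everywhere x with partition x
  ... | fzero , x∈ , _ = x∈
colourable⇒2≤ _ (suc (suc m)) _ = s≤s (s≤s z≤n)

-- A single edge on its own vertices is a tight cycle, a tight path and a loose path. For `n ≥ 2` it
-- is no loose cycle, as consecutive edges would meet in more than one vertex.
fullEdge : ∀ n → Hypergraph n
fullEdge n = hypergraph (_≡ full)

fullEdge-uniform : ∀ n → Uniform n (fullEdge n)
fullEdge-uniform n _ refl = ∣⊤∣≡n n

∀∈⇒≡full : ∀ {s : Subset n} → (∀ x → x ∈ s) → s ≡ full
∀∈⇒≡full ∀∈ = ⊆-antisym ⊆⊤ (λ {x} _ → ∀∈ x)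

-- The offset is `x - i` modulo `n`, with `d ∸ toℕ i` standing for `-i`. Hence a cyclic window of
-- length `n` is the whole vertex set, wherever it starts.
⊕-transitive : ∀ (i x : Fin n) → ∃[ j ] j < n × x ≡ i ⊕ j
⊕-transitive {d@(suc _)} i x = j , m%n<n (toℕ x + (d ∸ toℕ i)) d , Fin.toℕ-injective (sym (begin
  toℕ (i ⊕ j)                                ≡⟨ Fin.toℕ-fromℕ< (m%n<n (toℕ i + j) d) ⟩
  (toℕ i + j) % d                            ≡⟨ cong (λ t → (t + j) % d) (m<n⇒m%n≡m (Fin.toℕ<n i)) ⟨
  (toℕ i % d + j) % d                        ≡⟨ %-distribˡ-+ (toℕ i) (toℕ x + (d ∸ toℕ i)) d ⟨
  (toℕ i + (toℕ x + (d ∸ toℕ i))) % d        ≡⟨ cong (_% d) (shuffle (toℕ i) (toℕ x) (d ∸ toℕ i)) ⟩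
  (toℕ x + (toℕ i + (d ∸ toℕ i))) % d        ≡⟨ cong (λ t → (toℕ x + t) % d) (m+[n∸m]≡n (<⇒≤ (Fin.toℕ<n i))) ⟩
  (toℕ x + d) % d                            ≡⟨ [m+n]%n≡m%n (toℕ x) d ⟩
  toℕ x % d                                  ≡⟨ m<n⇒m%n≡m (Fin.toℕ<n x) ⟩
  toℕ x                                      ∎))
  where
  open ≡-Reasoning
  j : ℕ
  j = (toℕ x + (d ∸ toℕ i)) % d
  shuffle : ∀ a b c → a + (b + c) ≡ b + (a + c)
  shuffle = solve-∀

tightCycle-hasEdge : ∀ k → 1 ≤ k → HasEdge (TightCycle k)
tightCycle-hasEdge k@(suc _) _ = k , fullEdge k ,
  (fullEdge-uniform k , ≤-refl , Permutation.id , λ s → mk⇔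
    (λ { refl → fzero , λ x → mk⇔ (λ _ → ⊕-transitive fzero x) (λ _ → ∈⊤) })
    (λ (i , window) → ∀∈⇒≡full λ x → from (window x) (⊕-transitive i x))) ,
  full , refl

tightPath-hasEdge : ∀ k → HasEdge (TightPath k)
tightPath-hasEdge k = k , fullEdge k ,
  (fullEdge-uniform k , ≤-refl , Permutation.id , λ s → mk⇔
    (λ { refl → 0 , z≤n , λ x → mk⇔ (λ _ → x , z≤n , Fin.toℕ<n x , refl) (λ _ → ∈⊤) })
    -- The bound on `i` is `k ∸ k`, so the window starts at 0.
    (λ { (i , i≤ , window) → ∀∈⇒≡full λ x → from (window x)
      (x , ≤-trans i≤ (≤-trans (≤-reflexive (n∸n≡0 k)) z≤n) , ≤-trans (Fin.toℕ<n x) (m≤n+m k i) , refl) })) ,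
  full , refl

loosePath-hasEdge : ∀ k → HasEdge (LoosePath k)
loosePath-hasEdge k = k , fullEdge k , (fullEdge-uniform k , record
  { l = 0
  ; e = λ _ → full
  ; v = λ ()
  ; edges = λ s → mk⇔ (λ s≡ → fzero , s≡) proj₂
  ; consecutive = λ ()
  ; distinct = λ { {()} }
  ; disjoint = λ { fzero fzero () }
  ; covering = λ x → fzero , ∈⊤
  }) , full , refl

-- A triangle (three edges of size 2 on three vertices), with q private vertices
-- added to each edge, three at a time and at the front.
triangleEdge : ∀ q → Fin 3 → Subset (3 + q * 3)
triangleEdge zero = λ
  { fzero → inside ∷ inside ∷ outside ∷ []
  ; (fsuc fzero) → outside ∷ inside ∷ inside ∷ []
  ; (fsuc (fsuc fzero)) → inside ∷ outside ∷ inside ∷ [] }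
triangleEdge (suc q) i = ⁅ i ⁆ Vec.++ triangleEdge q i

triangleEdge-size : ∀ q i → ∣ triangleEdge q i ∣ ≡ q + 2
triangleEdge-size zero fzero = refl
triangleEdge-size zero (fsuc fzero) = refl
triangleEdge-size zero (fsuc (fsuc fzero)) = refl
triangleEdge-size (suc q) fzero = cong suc (triangleEdge-size q fzero)
triangleEdge-size (suc q) (fsuc fzero) = cong suc (triangleEdge-size q (fsuc fzero))
triangleEdge-size (suc q) (fsuc (fsuc fzero)) = cong suc (triangleEdge-size q (fsuc (fsuc fzero)))

-- In the triangle the edge `i` joins `i` to `i ⊕ 1`, and the latter lies on the next edge too; each
-- round of private vertices at the front shifts it by three.
triangleVertex : ∀ q → Fin 3 → Fin (3 + q * 3)
triangleVertex zero i = i ⊕ 1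
triangleVertex (suc q) i = fsuc (fsuc (fsuc (triangleVertex q i)))

triangleEdge-consecutive : ∀ q i → triangleEdge q i ∩ triangleEdge q (i ⊕ 1) ≡ ⁅ triangleVertex q i ⁆
triangleEdge-consecutive zero fzero = refl
triangleEdge-consecutive zero (fsuc fzero) = refl
triangleEdge-consecutive zero (fsuc (fsuc fzero)) = refl
triangleEdge-consecutive (suc q) i@fzero = cong (λ s → outside ∷ outside ∷ outside ∷ s) (triangleEdge-consecutive q i)
triangleEdge-consecutive (suc q) i@(fsuc fzero) = cong (λ s → outside ∷ outside ∷ outside ∷ s) (triangleEdge-consecutive q i)
triangleEdge-consecutive (suc q) i@(fsuc (fsuc fzero)) = cong (λ s → outside ∷ outside ∷ outside ∷ s) (triangleEdge-consecutive q i)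

triangleVertex-injective : ∀ q {i j} → triangleVertex q i ≡ triangleVertex q j → i ≡ j
triangleVertex-injective zero {i} {j} eq =
  trans (sym (⊕1⊕2 i)) (trans (cong (_⊕ 2) eq) (⊕1⊕2 j))
  where
  ⊕1⊕2 : ∀ (i : Fin 3) → (i ⊕ 1) ⊕ 2 ≡ i
  ⊕1⊕2 fzero = refl
  ⊕1⊕2 (fsuc fzero) = refl
  ⊕1⊕2 (fsuc (fsuc fzero)) = refl
triangleVertex-injective (suc q) eq =
  triangleVertex-injective q (Fin.suc-injective (Fin.suc-injective (Fin.suc-injective eq)))

triangleEdge-covering : ∀ q x → ∃[ i ] x ∈ triangleEdge q i
triangleEdge-covering zero fzero = fzero , here
triangleEdge-covering zero (fsuc fzero) = fzero , there here
triangleEdge-covering zero (fsuc (fsuc fzero)) = fsuc fzero , there (there here)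
triangleEdge-covering (suc q) fzero = fzero , here
triangleEdge-covering (suc q) (fsuc fzero) = fsuc fzero , there here
triangleEdge-covering (suc q) (fsuc (fsuc fzero)) = fsuc (fsuc fzero) , there (there here)
triangleEdge-covering (suc q) (fsuc (fsuc (fsuc x)))
  with triangleEdge-covering q x
... | fzero , x∈ = fzero , there (there (there x∈))
... | fsuc fzero , x∈ = fsuc fzero , there (there (there x∈))
... | fsuc (fsuc fzero) , x∈ = fsuc (fsuc fzero) , there (there (there x∈))

-- Modulo 3 the only nonzero differences are 1 and -1, so a cycle of three edges has no
-- non-consecutive ones and its disjointness condition is vacuous.
Fin3-consecutive : ∀ (i j : Fin 3) → i ≢ j → j ≢ i ⊕ 1 → i ≡ j ⊕ 1
Fin3-consecutive fzero fzero i≢j _ = contradiction refl i≢j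
Fin3-consecutive fzero (fsuc fzero) _ j≢ = contradiction refl j≢
Fin3-consecutive fzero (fsuc (fsuc fzero)) _ _ = refl
Fin3-consecutive (fsuc fzero) fzero _ _ = refl
Fin3-consecutive (fsuc fzero) (fsuc fzero) i≢j _ = contradiction refl i≢j
Fin3-consecutive (fsuc fzero) (fsuc (fsuc fzero)) _ j≢ = contradiction refl j≢
Fin3-consecutive (fsuc (fsuc fzero)) fzero _ j≢ = contradiction refl j≢
Fin3-consecutive (fsuc (fsuc fzero)) (fsuc fzero) _ _ = refl
Fin3-consecutive (fsuc (fsuc fzero)) (fsuc (fsuc fzero)) i≢j _ = contradiction refl i≢j

looseCycle-hasEdge : ∀ k → 2 ≤ k → HasEdge (LooseCycle k)
looseCycle-hasEdge k 2≤k = _ , hypergraph (λ s → ∃[ i ] s ≡ e i) ,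
  ( (λ { _ (i , refl) → trans (triangleEdge-size q i) (m∸n+n≡m 2≤k) })
  , record
    { m = 3
    ; 1≤m = s≤s z≤n
    ; e = e
    ; v = triangleVertex q
    ; edges = λ s → mk⇔ id id
    ; consecutive = triangleEdge-consecutive q
    ; distinct = triangleVertex-injective q
    ; disjoint = λ i j i≢j j≢ i≢ → contradiction (Fin3-consecutive i j i≢j j≢) i≢
    ; covering = triangleEdge-covering q
    }) , e fzero , fzero , refl
  where
  q : ℕ
  -- Two of the `k` vertices of an edge are corners of the triangle; the others are private.
  q = k ∸ 2
  e : Fin 3 → Subset (3 + q * 3)
  e = triangleEdge q

corollary2p2 : (k : ℕ) → 3 ≤ k →
    (χ-co (TightCycle k) is 2) × (χ-co (LooseCycle k) is 2) ×
    (χ-co (TightPath k) is 2) × (χ-co (LoosePath k) is 2)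
corollary2p2 k 3≤k =
  (colour-tights (proj₁ ∘ proj₂) (tightCycle-tight 3≤k) ,
    colourable⇒2≤ (tightCycle-hasEdge k (≤-trans (s≤s z≤n) 3≤k))) ,
  ((λ n H H∈ → colour-paired H (looseCycle-paired 3≤k ∘ H∈)) ,
    colourable⇒2≤ (looseCycle-hasEdge k (≤-trans (n≤1+n 2) 3≤k))) ,
  (colour-tights (proj₁ ∘ proj₂) (tightPath-tight 3≤k) ,
    colourable⇒2≤ (tightPath-hasEdge k)) ,
  ((λ n H H∈ → colour-paired H (loosePath-paired 3≤k ∘ H∈)) ,
    colourable⇒2≤ (loosePath-hasEdge k))
  where
  colour-tights : ∀ {𝓗 : HypergraphClass} → (∀ {n} {H : Hypergraph n} → 𝓗 n H → k ≤ n) →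
    (∀ {n} {H : Hypergraph n} → 𝓗 n H → Tight H) → CooperativelyColorable 𝓗 2
  colour-tights k≤n tight n H H∈ =
    colour-tight H (≤-trans (n≤1+n 2) (≤-trans 3≤k (k≤n (H∈ fzero)))) (tight ∘ H∈)
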